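{- Let $G=(V,E)$ be a (possibly infinite) directed graph in which every vertex has finite in-degree. Then $G$ has a quasi-kernel.
   Context: A digraph (directed graph) is a pair $G=(V,E)$ with $E\subseteq V\times V$; $V$ may be infinite. A set $A\subseteq V$ is independent if there is no edge (in either direction) between two distinct elements of $A$. An independent set $A\subseteq V$ is a quasi-kernel of $G$ if for each $v\in V$ there is a directed path of length at most $2$ from some point of $A$ to $v$ (length $0$ is allowed). -}

module Defs where

open import Data.List.Base using (List; _∷_; length; last)
open import Data.List.Membership.Propositional using (_∈_)
open import Data.List.Relation.Unary.Linked using (Linked)
open import Data.List.Relation.Unary.Unique.Propositional using (Unique)
open import Data.Maybe.Base using (just)
open import Data.Nat.Base using (ℕ; _≤_)
open import Data.Product.Base using (_×_; ∃-syntax; Σ-syntax)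
open import Data.Sum.Base using (_⊎_)
open import Function.Bundles using (_⇔_)
open import Level using (Level; _⊔_; suc)
open import Relation.Binary.Core using (Rel)
open import Relation.Binary.PropositionalEquality.Core using (_≡_; _≢_)
open import Relation.Nullary.Negation.Core using (¬_)
open import Relation.Unary using (Pred)

-- No restriction on E: loops and pairs of opposite edges are allowed.
record Digraph (v e : Level) : Set (suc (v ⊔ e)) where
  field
    V : Set v
    E : Rel V e

module _ {v e : Level} (G : Digraph v e) where
  open Digraph G

  -- A finite set is one whose elements are exactly those of some list.
  FiniteInDegree : V → Set (v ⊔ e)
  FiniteInDegree y = ∃[ xs ] (∀ x → E x y ⇔ x ∈ xs)

  -- A directed path x → z₁ → … → zₙ = y with pairwise distinct vertices;
  -- the list `tail` is z₁ , … , zₙ, so its length is the number of edges.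
  record Path (x y : V) : Set (v ⊔ e) where
    field
      tail     : List V
      linked   : Linked E (x ∷ tail)
      distinct : Unique (x ∷ tail)
      ends     : last (x ∷ tail) ≡ just y

  pathLength : ∀ {x y} → Path x y → ℕ
  pathLength p = length (Path.tail p)

  Independent : ∀ {a} → Pred V a → Set (v ⊔ e ⊔ a)
  Independent A = ∀ {x y} → A x → A y → x ≢ y → ¬ (E x y ⊎ E y x)

  record IsQuasiKernel {a} (A : Pred V a) : Set (v ⊔ e ⊔ a) where
    field
      independent : Independent A
      reaches     : ∀ y → ∃[ x ] A x × (Σ[ p ∈ Path x y ] pathLength p ≤ 2)

{-# OPTIONS --safe #-}
-- Compactness.  A vertex is reached within two steps only from a finite list of
-- sources, so a quasi-kernel is an independent set meeting each of these lists.
-- Finite digraphs have quasi-kernels (Chvátal–Lovász): discard v together with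
-- its out-neighbours, take a quasi-kernel Q of the rest, and add v to Q unless Q
-- has an edge into v.  Call a set B of vertices good if for all finite W ⊆ B and
-- all finite F some independent set avoids W and reaches F.  Being good has
-- finite character, so there is a maximal good set; its complement is a
-- quasi-kernel, because an independent set omits an end of every proper edge.
module Submission where

open import Defs
open import Axiom.ExcludedMiddle using (ExcludedMiddle)
open import Axiom.Extensionality.Propositional using (Extensionality; lower-extensionality)
open import Data.Bool.Base using (Bool; _∨_; T)
open import Data.Bool.Properties using (T?; T-∨; T-≡; ⇔→≡)
open import Data.List.Base using (List; []; _∷_; _++_; length; concatMap; filter)
open import Data.List.Membership.Propositional using (_∈_; _∉_; lose)
open import Data.List.Membership.Propositional.Properties
  using (∈-++⁺ˡ; ∈-++⁺ʳ; ∈-filter⁺; ∈-filter⁻; ∈-concatMap⁺)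
open import Data.List.Properties using (length-filter)
open import Data.List.Relation.Binary.Subset.Propositional using () renaming (_⊆_ to _⊆ₗ_)
open import Data.List.Relation.Unary.All using (All; []; _∷_)
open import Data.List.Relation.Unary.All.Properties using (all-filter)
import Data.List.Relation.Unary.All as All
open import Data.List.Relation.Unary.AllPairs using ([]; _∷_)
open import Data.List.Relation.Unary.Any using (here; there)
open import Data.List.Relation.Unary.Linked using ([-]; _∷_)
open import Data.Nat.Base using (suc; _≤_; z≤n; s≤s)
open import Data.Nat.Properties using (≤-refl; ≤-trans)
open import Data.Product.Base using (Σ-syntax; ∃-syntax; ∃; _×_; _,_; proj₁; proj₂)
open import Data.Sum.Base using (_⊎_; inj₁; inj₂; [_,_]′)
open import Function.Base using (_∘_; id; case_of_)
open import Function.Bundles using (Equivalence)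
open import Level using (Level; _⊔_; Lift; lift; lower; 0ℓ)
open import Relation.Binary.PropositionalEquality using (_≡_; _≢_; refl)
open import Relation.Nullary.Decidable
  using (Dec; yes; no; map′; ⌊_⌋; toWitness; fromWitness; decidable-stable; ¬?)
open import Relation.Nullary.Negation using (¬_; contradiction)
open import Relation.Unary using (Pred)

lower-excludedMiddle : ∀ a b → ExcludedMiddle (a ⊔ b) → ExcludedMiddle a
lower-excludedMiddle a b em {P} = map′ lower lift (em {Lift b P})

-- Subsets are Bool-valued, so that the power set of A stays in the universe of A.
module Subsets {a} {A : Set a} where

  Subset : Set a
  Subset = A → Bool

  infix 4 _∈ₛ_ _⊆_
  _∈ₛ_ : A → Subset → Set
  x ∈ₛ X = T (X x)

  _⊆_ : Subset → Subset → Set a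
  X ⊆ Y = ∀ x → x ∈ₛ X → x ∈ₛ Y

  ⊆-antisym : Extensionality a 0ℓ → ∀ {X Y} → X ⊆ Y → Y ⊆ X → X ≡ Y
  ⊆-antisym ext X⊆Y Y⊆X = ext λ x → ⇔→≡ (record
    { to        = Equivalence.to T-≡ ∘ X⊆Y x ∘ Equivalence.from T-≡
    ; from      = Equivalence.to T-≡ ∘ Y⊆X x ∘ Equivalence.from T-≡
    ; to-cong   = λ { refl → refl }
    ; from-cong = λ { refl → refl }
    })

-- The Teichmüller-Tukey lemma, by Zermelo's towers.

module TeichmüllerTukey {a ℓ} {A : Set a} (em : ExcludedMiddle (a ⊔ ℓ))
  (ext : Extensionality a 0ℓ) (P : List A → Set ℓ) where

  open Subsets {A = A} public

  private
    emₐ : ExcludedMiddle a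
    emₐ = lower-excludedMiddle a ℓ em

  Good : Subset → Set (a ⊔ ℓ)
  Good X = ∀ W → All (_∈ₛ X) W → P W

  insert : A → Subset → Subset
  insert x X y = X y ∨ ⌊ emₐ {y ≡ x} ⌋

  insert⁺ : ∀ {x y X} → y ∈ₛ X ⊎ y ≡ x → y ∈ₛ insert x X
  insert⁺ {x} {y} {X} = Equivalence.from (T-∨ {X y}) ∘
    [ inj₁ , inj₂ ∘ fromWitness {a? = emₐ} ]′

  insert⁻ : ∀ {x y X} → y ∈ₛ insert x X → y ∈ₛ X ⊎ y ≡ x
  insert⁻ {x} {y} {X} m =
    [ inj₁ , inj₂ ∘ toWitness {a? = emₐ} ]′ (Equivalence.to (T-∨ {X y}) m)

  -- Families are Bool-valued too: `union` can then range over all of them while `Tower` stays in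
  -- `Set a`, and `emₐ` can turn `Tower` itself into a family.
  ⋃ : (Subset → Bool) → Subset
  ⋃ φ x = ⌊ emₐ {∃[ X ] T (φ X) × x ∈ₛ X} ⌋

  Extends : Subset → A → Set (a ⊔ ℓ)
  Extends X x = ¬ x ∈ₛ X × Good (insert x X)

  -- A positive answer of `em` carries a witness, so `em` acts as the choice function.
  next : Subset → Subset
  next X with em {∃ (Extends X)}
  ... | yes (x , _) = insert x X
  ... | no  _       = X

  ⊆-next : ∀ X → X ⊆ next X
  ⊆-next X y y∈X with em {∃ (Extends X)}
  ... | yes (x , _) = insert⁺ {X = X} (inj₁ y∈X)
  ... | no  _       = y∈X

  next-good : ∀ {X} → Good X → Good (next X)
  next-good {X} good with em {∃ (Extends X)}
  ... | yes (_ , _ , good′) = good′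
  ... | no  _               = good

  next-closed⇒maximal : ∀ {X} → next X ⊆ X → ∀ x → ¬ x ∈ₛ X → ¬ Good (insert x X)
  next-closed⇒maximal {X} closed x x∉X good with em {∃ (Extends X)}
  ... | yes (y , y∉X , _) = y∉X (closed y (insert⁺ {X = X} (inj₂ refl)))
  ... | no  none          = none (x , x∉X , good)

  -- Replaces transfinite iteration of `next`; the union of the empty family supplies the empty set
  -- as a start.
  data Tower : Subset → Set a where
    step  : ∀ {X} → Tower X → Tower (next X)
    union : ∀ φ → (∀ X → T (φ X) → Tower X) → Tower (⋃ φ)

  tower-dichotomy : ∀ {X Y} → Tower X → Tower Y → X ⊆ Y ⊎ next Y ⊆ X
  tower-dichotomy {Y = Y} (step {X} t) u with tower-dichotomy t u
  ... | inj₂ Y′⊆X = inj₂ λ x m → ⊆-next X x (Y′⊆X x m)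
  ... | inj₁ X⊆Y with tower-dichotomy u t
  ...   | inj₂ X′⊆Y = inj₁ X′⊆Y
  -- Mutual inclusion alone would not do: `next` could choose differently for subsets not known to
  -- be equal.
  ...   | inj₁ Y⊆X rewrite ⊆-antisym ext X⊆Y Y⊆X = inj₂ λ _ → id
  tower-dichotomy {Y = Y} (union φ ts) u
    with emₐ {∃[ X ] T (φ X) × next Y ⊆ X}
  ... | yes (X , X∈φ , Y′⊆X) =
    inj₂ λ x m → fromWitness (X , X∈φ , Y′⊆X x m)
  ... | no none = inj₁ λ x m → case toWitness m of λ where
    (X , X∈φ , x∈X) → case tower-dichotomy (ts X X∈φ) u of λ where
      (inj₁ X⊆Y)  → X⊆Y x x∈X
      (inj₂ Y′⊆X) → contradiction (X , X∈φ , Y′⊆X) none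

  tower-total : ∀ {X Y} → Tower X → Tower Y → X ⊆ Y ⊎ Y ⊆ X
  tower-total {Y = Y} t u with tower-dichotomy t u
  ... | inj₁ X⊆Y  = inj₁ X⊆Y
  ... | inj₂ Y′⊆X = inj₂ λ x → Y′⊆X x ∘ ⊆-next Y x

  -- Tower members form a chain, so the larger of two absorbs both. The list is nonempty because an
  -- empty family has no member to return.
  finite⊆⋃ : ∀ φ → (∀ X → T (φ X) → Tower X) → ∀ w W → All (_∈ₛ ⋃ φ) (w ∷ W) →
             ∃[ X ] T (φ X) × All (_∈ₛ X) (w ∷ W)
  finite⊆⋃ φ ts w []       (m ∷ []) = case toWitness m of λ where
    (X , X∈φ , w∈X) → X , X∈φ , w∈X ∷ []
  finite⊆⋃ φ ts w (w′ ∷ W) (m ∷ ms) with toWitness m | finite⊆⋃ φ ts w′ W ms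
  ... | X , X∈φ , w∈X | Y , Y∈φ , W⊆Y with tower-total (ts X X∈φ) (ts Y Y∈φ)
  ...   | inj₁ X⊆Y = Y , Y∈φ , X⊆Y w w∈X ∷ W⊆Y
  ...   | inj₂ Y⊆X = X , X∈φ , w∈X ∷ All.map (Y⊆X _) W⊆Y

  tower-good : P [] → ∀ {X} → Tower X → Good X
  tower-good p[] (step t)     = next-good (tower-good p[] t)
  tower-good p[] (union φ ts) []      _  = p[]
  tower-good p[] (union φ ts) (w ∷ W) ms with finite⊆⋃ φ ts w W ms
  ... | X , X∈φ , W⊆X = tower-good p[] (ts X X∈φ) (w ∷ W) W⊆X

  -- The union of the whole tower is itself in the tower, hence so is its `next`, which therefore
  -- lies inside that union.
  maximal-good : P [] → ∃[ M ] Good M × (∀ x → ¬ x ∈ₛ M → ¬ Good (insert x M))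
  maximal-good p[] = ⋃ φ , tower-good p[] top , next-closed⇒maximal
      λ x m → fromWitness (next (⋃ φ) , fromWitness (step top) , m)
    where
    φ : Subset → Bool
    φ X = ⌊ emₐ {Tower X} ⌋

    top : Tower (⋃ φ)
    top = union φ λ _ → toWitness

-- Short walks and the finite case.

module QuasiKernel {v e} (em : ExcludedMiddle (v ⊔ e)) (G : Digraph v e) where
  open Digraph G

  private
    emᵥ : ExcludedMiddle v
    emᵥ = lower-excludedMiddle v e em

    emₑ : ExcludedMiddle e
    emₑ = lower-excludedMiddle e v em

  -- Walks, whose vertices may repeat; `within2⇒path` cuts out the repetitions once at the end.
  data Within2 (x : V) : V → Set (v ⊔ e) where
    zero : Within2 x x
    one  : ∀ {y} → E x y → Within2 x y
    two  : ∀ {y z} → E x z → E z y → Within2 x y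

  edge-path : ∀ {x y} → E x y → Σ[ p ∈ Path G x y ] pathLength G p ≤ 2
  edge-path {x} {y} xy with emᵥ {x ≡ y}
  ... | yes refl = record
    { tail = [] ; linked = [-] ; distinct = [] ∷ [] ; ends = refl } , z≤n
  ... | no x≢y = record
    { tail = y ∷ [] ; linked = xy ∷ [-] ; distinct = (x≢y ∷ []) ∷ [] ∷ [] ; ends = refl
    } , s≤s z≤n

  within2⇒path : ∀ {x y} → Within2 x y → Σ[ p ∈ Path G x y ] pathLength G p ≤ 2
  within2⇒path zero = record
    { tail = [] ; linked = [-] ; distinct = [] ∷ [] ; ends = refl } , z≤n
  within2⇒path (one xy) = edge-path xy
  within2⇒path {x} {y} (two {z = z} xz zy)
    with emᵥ {x ≡ y} | emᵥ {x ≡ z} | emᵥ {z ≡ y}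
  ... | yes refl | _        | _        = within2⇒path zero
  ... | no  _    | yes refl | _        = edge-path zy
  ... | no  _    | no  _    | yes refl = edge-path xz
  ... | no  x≢y  | no  x≢z  | no  z≢y  = record
    { tail     = z ∷ y ∷ []
    ; linked   = xz ∷ zy ∷ [-]
    ; distinct = (x≢z ∷ x≢y ∷ []) ∷ (z≢y ∷ []) ∷ [] ∷ []
    ; ends     = refl
    } , s≤s (s≤s z≤n)

  Reaches : List V → V → Set (v ⊔ e)
  Reaches Q y = ∃[ x ] x ∈ Q × Within2 x y

  -- The bound `n` carries the recursion, as a filtered list is not a subterm.
  finite-quasiKernel : ∀ n W → length W ≤ n →
    ∃[ Q ] Q ⊆ₗ W × Independent G (_∈ Q) × (∀ {w} → w ∈ W → Reaches Q w)
  finite-quasiKernel _       []      _         = [] , id , (λ ()) , λ ()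
  finite-quasiKernel (suc n) (u ∷ W) (s≤s W≤n)
    with finite-quasiKernel n (filter (λ w → ¬? (emₑ {E u w})) W)
           (≤-trans (length-filter (λ w → ¬? (emₑ {E u w})) W) W≤n)
  ... | Q , Q⊆ , indep , reach = extend em
    where
    rest : ∀ {q} → q ∈ Q → q ∈ W × ¬ E u q
    rest = ∈-filter⁻ (λ w → ¬? (emₑ {E u w})) ∘ Q⊆

    cover : ∀ {Q′} → Reaches Q′ u → (∀ {w} → E u w → Reaches Q′ w) →
            (∀ {w} → w ∈ filter (λ w → ¬? (emₑ {E u w})) W → Reaches Q′ w) →
            ∀ {w} → w ∈ u ∷ W → Reaches Q′ w
    cover self out others (here refl) = self
    cover self out others {w} (there w∈W) with emₑ {E u w}
    ... | yes uw  = out uw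
    ... | no  ¬uw = others (∈-filter⁺ (λ w → ¬? (emₑ {E u w})) w∈W ¬uw)

    extend : Dec (∃[ q ] q ∈ Q × E q u) →
      ∃[ Q′ ] Q′ ⊆ₗ u ∷ W × Independent G (_∈ Q′) × (∀ {w} → w ∈ u ∷ W → Reaches Q′ w)
    extend (yes (q , q∈Q , qu)) =
        Q
      , there ∘ proj₁ ∘ rest
      , indep
      , cover (q , q∈Q , one qu) (λ uw → q , q∈Q , two qu uw) reach
    extend (no none) =
        u ∷ Q
      , (λ { (here refl) → here refl ; (there m) → there (proj₁ (rest m)) })
      -- Edges from `Q` into `u` are excluded by `none`, edges from `u` into `Q` by the filter.
      , (λ { (here refl) (here refl) u≢u _ → u≢u refl
           ; (here refl) (there m) _ (inj₁ uy) → proj₂ (rest m) uy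
           ; (here refl) (there m) _ (inj₂ yu) → none (_ , m , yu)
           ; (there m) (here refl) _ (inj₁ xu) → none (_ , m , xu)
           ; (there m) (here refl) _ (inj₂ ux) → proj₂ (rest m) ux
           ; (there m) (there m′) → indep m m′ })
      , cover (u , here refl , zero) (λ uw → u , here refl , one uw)
          λ m → case reach m of λ (x , x∈Q , r) → x , there x∈Q , r

  -- Compactness for finite in-degree.

  module _ (finite : ∀ y → FiniteInDegree G y) where

    predecessors : V → List V
    predecessors y = proj₁ (finite y)

    ∈-predecessors : ∀ {x y} → E x y → x ∈ predecessors y
    ∈-predecessors {x} {y} = Equivalence.to (proj₂ (finite y) x)

    sources : V → List V
    sources y = y ∷ predecessors y ++ concatMap predecessors (predecessors y)

    ∈-sources : ∀ {x y} → Within2 x y → x ∈ sources y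
    ∈-sources zero        = here refl
    ∈-sources (one xy)    = there (∈-++⁺ˡ (∈-predecessors xy))
    ∈-sources {y = y} (two xz zy) = there (∈-++⁺ʳ (predecessors y)
      (∈-concatMap⁺ predecessors (lose (∈-predecessors zy) (∈-predecessors xz))))

  ReachableAvoiding : List V → List V → Set (v ⊔ e)
  ReachableAvoiding F W = ∃[ Q ] Independent G (_∈ Q) ×
    (∀ {x} → x ∈ W → x ∉ Q) × (∀ {y} → y ∈ F → Reaches Q y)

  Avoidable : List V → Set (v ⊔ e)
  Avoidable W = ∀ F → ReachableAvoiding F W

  avoidable-[] : Avoidable []
  avoidable-[] F with finite-quasiKernel (length F) F ≤-refl
  ... | Q , _ , indep , reach = Q , indep , (λ ()) , reach

  module _ (ext : Extensionality v 0ℓ) (finite : ∀ y → FiniteInDegree G y) where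
    open TeichmüllerTukey em ext Avoidable

    quasiKernel : Σ[ A ∈ Pred V (v ⊔ e) ] IsQuasiKernel G A
    quasiKernel with maximal-good avoidable-[]
    ... | M , good , maximal = (λ x → Lift (v ⊔ e) (¬ x ∈ₛ M)) , record
      { independent = λ (lift x∉M) (lift y∉M) → independent x∉M y∉M
      ; reaches     = λ y → decidable-stable em (reaches y)
      }
      where
      M? : ∀ x → Dec (x ∈ₛ M)
      M? x = T? (M x)

      -- Only `z` can be an element of `W` outside `M`, so avoiding `z` and the part of `W′` in `M`
      -- is enough.
      restrict : ∀ {z W W′ F F′ Q} → W ⊆ₗ W′ → F ⊆ₗ F′ → All (_∈ₛ insert z M) W → z ∉ Q →
                 Independent G (_∈ Q) → (∀ {w} → w ∈ filter M? W′ → w ∉ Q) →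
                 (∀ {y} → y ∈ F′ → Reaches Q y) → ReachableAvoiding F W
      restrict {Q = Q} W⊆W′ F⊆F′ W⊆M+z z∉Q indep avoid reach =
          Q , indep
        , (λ w∈W w∈Q → case insert⁻ {X = M} (All.lookup W⊆M+z w∈W) of λ where
            (inj₁ w∈M)  → avoid (∈-filter⁺ M? (W⊆W′ w∈W) w∈M) w∈Q
            (inj₂ refl) → z∉Q w∈Q)
        , reach ∘ F⊆F′

      -- A single `Q` is taken for both pairs of lists at once; being independent, it omits `x` or
      -- `y` and then serves the corresponding pair.
      omit-end : ∀ {x y W₁ W₂ F₁ F₂} → x ≢ y → E x y ⊎ E y x →
        All (_∈ₛ insert x M) W₁ → All (_∈ₛ insert y M) W₂ →
        ReachableAvoiding F₁ W₁ ⊎ ReachableAvoiding F₂ W₂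
      omit-end {x} {y} {W₁} {W₂} {F₁} {F₂} x≢y edge W₁⊆ W₂⊆
        with good (filter M? (W₁ ++ W₂)) (all-filter M? (W₁ ++ W₂)) (F₁ ++ F₂)
      ... | Q , indep , avoid , reach with em {Lift (v ⊔ e) (x ∈ Q)}
      ...   | no  x∉Q        =
        inj₁ (restrict ∈-++⁺ˡ ∈-++⁺ˡ W₁⊆ (x∉Q ∘ lift) indep avoid reach)
      ...   | yes (lift x∈Q) =
        inj₂ (restrict (∈-++⁺ʳ W₁) (∈-++⁺ʳ F₁) W₂⊆
          (λ y∈Q → indep x∈Q y∈Q x≢y edge) indep avoid reach)

      -- By maximality, adding either end of an edge to `M` fails for some pair of lists; `omit-end`
      -- shows that the two failures cannot coexist.
      independent : Independent G (λ x → ¬ x ∈ₛ M)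
      independent {x} {y} x∉M y∉M x≢y edge =
        maximal x x∉M λ W₁ W₁⊆ F₁ → decidable-stable em λ none₁ →
        maximal y y∉M λ W₂ W₂⊆ F₂ → decidable-stable em λ none₂ →
        [ none₁ , none₂ ]′ (omit-end x≢y edge W₁⊆ W₂⊆)

      -- Goodness is applied to the sources of `y` in `M`. The resulting `Q` avoids these, so the
      -- source from which it reaches `y` lies outside `M`.
      reaches : ∀ y → ¬ ¬ (∃[ x ] Lift (v ⊔ e) (¬ x ∈ₛ M) ×
                  (Σ[ p ∈ Path G x y ] pathLength G p ≤ 2))
      reaches y none
        with good (filter M? (sources finite y)) (all-filter M? (sources finite y)) (y ∷ [])
      ... | Q , _ , avoid , reach with reach (here refl)
      ...   | x , x∈Q , r with M? x
      ...     | yes x∈M = avoid (∈-filter⁺ M? (∈-sources finite r) x∈M) x∈Q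
      ...     | no  x∉M = none (x , lift x∉M , within2⇒path r)

corollary2p1 : {v e : Level} →
    ExcludedMiddle (v ⊔ e) →
    Extensionality (v ⊔ e) (v ⊔ e) →
    (G : Digraph v e) →
    (∀ y → FiniteInDegree G y) →
    Σ[ A ∈ Pred (Digraph.V G) (v ⊔ e) ] IsQuasiKernel G A
corollary2p1 {v} {e} em ext G =
  QuasiKernel.quasiKernel em G (lower-extensionality e (v ⊔ e) ext)
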